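{- Let $m\ge 2$ and $n\ge 1$ be integers. The diameter of the transition graph $G(R_{m,n})$ of the robot of length $n$ in a tunnel of width $m$ is $$\operatorname{diam} G(R_{m,n})=\begin{cases} d(L_{m,n},H_{m,n}) & \text{for } n<6,\\ d(L_{m,n},L_{m,n}^+) & \text{for } n\ge 6,\end{cases}$$ where $d$ is the graph distance in $G(R_{m,n})$. These distances are explicitly given by $$d(L_{m,n},H_{m,n})=s_n-z_{m,n},\qquad d(L_{m,n},L_{m,n}^+)=s_{n-1}-z_{m,n}+s_{n-2}-z_{m,m+n-3},$$ where $s_n=\binom{n+1}{2}$ and $z_{m,n}=(r+1)k+\binom{k}{2}(m+1)$ with $n=(m+1)k+r$, $0\le r\le m$.
   Context: **Positions.** A position of the robotic arm $R_{m,n}$ is a lattice path of $n$ unit links starting at $(0,0)$, each link facing up ($u$), down ($d$) or right ($r$), staying in the strip $0\le y\le m$ and not intersecting itself; equivalently a word in $\{u,d,r\}^n$ with no two consecutive letters $ud$ or $du$ and all heights in $[0,m]$. **Moves and transition graph.** (Switch corners) two consecutive links facing different directions (one vertical, one horizontal) interchange directions; (flip the end) the last link rotates by $90^\circ$ ($r\leftrightarrow u$ or $r\leftrightarrow d$). A move is legal only if its result is a position. The transition graph $G(R_{m,n})$ has the positions as vertices and the legal moves as edges; its diameter is the largest graph distance between two vertices. **Special positions.** $L_{m,n}$ (left justified) is the position given by the first $n$ letters of $u^m r d^m r u^m r d^m r\cdots$; $L_{m,n}^+$ (shifted left justified) is given by the first $n$ letters of $(urdr)(u^m r d^m r u^m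 r\cdots)$; $H_{m,n}=rr\cdots r$ is the fully horizontal position. -}

module Defs where

open import Data.Integer.Base as ℤ using (ℤ; +_; 0ℤ; 1ℤ; -1ℤ; +≤+)
open import Data.List.Base as List using (List; []; _∷_)
open import Data.List.NonEmpty as List⁺ using (List⁺; _∷_; _++⁺_; toList)
open import Data.Nat.Base using (ℕ; zero; suc; _+_; _*_; _≤_; z≤n; s≤s)
open import Data.Nat.Combinatorics using (_C_)
open import Data.Nat.DivMod using (_/_; _%_)
open import Data.Nat.Properties using (≤-refl; ≤-trans; ≤-reflexive; +-identityʳ; +-comm; +-suc; n≤1+n; m≤n+m)
open import Data.Product.Base using (_×_; _,_; proj₁; proj₂; ∃-syntax)
open import Data.Vec.Base as Vec using (Vec; []; _∷_)
open import Data.Vec.Relation.Unary.All using (All; []; _∷_)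
open import Data.Vec.Relation.Unary.Linked as Linked using (Linked; []; [-]; _∷_)
open import Relation.Binary.Core using (Rel)
open import Relation.Binary.PropositionalEquality using (_≡_; refl; sym; trans; cong; subst)
open import Relation.Nullary.Negation using (¬_)

------------------------------------------------------------------------
-- Distance and diameter in a graph given by its adjacency relation

module Graph {V : Set} (_∼_ : V → V → Set) where

  data Walk : V → V → ℕ → Set where
    nil  : ∀ {x} → Walk x x 0
    step : ∀ {x y z k} → x ∼ y → Walk y z k → Walk x z (suc k)

  IsDistance : V → V → ℕ → Set
  IsDistance x y k = Walk x y k × (∀ l → Walk x y l → k ≤ l)

  -- In particular the graph has to be connected.
  IsDiameter : ℕ → Set
  IsDiameter D = (∀ x y → ∃[ k ] (IsDistance x y k × k ≤ D))
               × (∃[ x ] ∃[ y ] IsDistance x y D)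

------------------------------------------------------------------------
-- Positions

data Link : Set where
  u d r : Link

rise : Link → ℤ
rise u = 1ℤ
rise d = -1ℤ
rise r = 0ℤ

-- The heights of all n + 1 vertices of the path, starting from height y.
heights : ∀ {n} → ℤ → Vec Link n → Vec ℤ (suc n)
heights y []      = y ∷ []
heights y (a ∷ w) = y ∷ heights (y ℤ.+ rise a) w

data Opposite : Link → Link → Set where
  ud : Opposite u d
  du : Opposite d u

-- As no link faces left, the path avoids itself exactly when no vertical link
-- is followed by its opposite.
record IsPosition (m : ℕ) {n : ℕ} (w : Vec Link n) : Set where
  field
    inStrip    : All (λ y → (0ℤ ℤ.≤ y) × (y ℤ.≤ + m)) (heights 0ℤ w)
    noReversal : Linked (λ a b → ¬ Opposite a b) w

-- The proof is irrelevant, so positions are equal when their words are.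
record Position (m n : ℕ) : Set where
  constructor position
  field
    word   : Vec Link n
    .valid : IsPosition m word

open Position public

------------------------------------------------------------------------
-- Moves and the transition graph

data _⟂_ : Link → Link → Set where
  u⟂r : u ⟂ r
  d⟂r : d ⟂ r
  r⟂u : r ⟂ u
  r⟂d : r ⟂ d

data Move : ∀ {n} → Vec Link n → Vec Link n → Set where
  switch : ∀ {n a b} {w : Vec Link n} → a ⟂ b → Move (a ∷ b ∷ w) (b ∷ a ∷ w)
  flip   : ∀ {a b} → a ⟂ b → Move (a ∷ []) (b ∷ [])
  later  : ∀ {n a} {v w : Vec Link n} → Move v w → Move (a ∷ v) (a ∷ w)

-- Legality is built in: both ends of an edge are positions.
Edge : ∀ {m n} → Position m n → Position m n → Set
Edge p q = Move (word p) (word q)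

module G (m n : ℕ) = Graph (Edge {m} {n})

------------------------------------------------------------------------
-- Special positions

-- The first n letters of the infinite word  as bs bs bs ⋯
prefix : (n : ℕ) (as : List Link) (bs : List⁺ Link) → Vec Link n
prefix zero    _        _           = []
prefix (suc n) (a ∷ as) bs          = a ∷ prefix n as bs
prefix (suc n) []       bs@(b ∷ cs) = b ∷ prefix n cs bs

-- uᵐ r dᵐ r
block : ℕ → List⁺ Link
block m = List.replicate m u ++⁺ (r ∷ (List.replicate m d List.++ r ∷ []))

L-word L⁺-word H-word : (m n : ℕ) → Vec Link n
L-word  m n = prefix n [] (block m)
L⁺-word m n = prefix n (u ∷ r ∷ d ∷ r ∷ []) (block m)
H-word  m n = Vec.replicate n r

private

  -- Path m a k w: the word w can follow the letter a, starting from height k.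
  data Path (m : ℕ) : Link → ℕ → ∀ {n} → Vec Link n → Set where
    end  : ∀ {a k} → k ≤ m → Path m a k []
    goU  : ∀ {a k n} {w : Vec Link n} → k ≤ m → ¬ Opposite a u →
           Path m u (suc k) w → Path m a k (u ∷ w)
    goD  : ∀ {a k n} {w : Vec Link n} → suc k ≤ m → ¬ Opposite a d →
           Path m d k w → Path m a (suc k) (d ∷ w)
    goR  : ∀ {a k n} {w : Vec Link n} → k ≤ m → ¬ Opposite a r →
           Path m r k w → Path m a k (r ∷ w)

  InStrip : ℕ → ℤ → Set
  InStrip m y = (0ℤ ℤ.≤ y) × (y ℤ.≤ + m)

  path-inStrip : ∀ {m a k n} {w : Vec Link n} → Path m a k w →
                 All (InStrip m) (heights (+ k) w)
  path-inStrip (end k≤m) = (+≤+ z≤n , +≤+ k≤m) ∷ []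
  path-inStrip {m} {k = k} {w = _ ∷ w} (goU k≤m _ p) = (+≤+ z≤n , +≤+ k≤m) ∷
    subst (λ l → All (InStrip m) (heights (+ l) w)) (+-comm 1 k) (path-inStrip p)
  path-inStrip (goD k≤m _ p) = (+≤+ z≤n , +≤+ k≤m) ∷ path-inStrip p
  path-inStrip {m} {k = k} {w = _ ∷ w} (goR k≤m _ p) = (+≤+ z≤n , +≤+ k≤m) ∷
    subst (λ l → All (InStrip m) (heights (+ l) w)) (sym (+-identityʳ k)) (path-inStrip p)

  path-linked : ∀ {m a k n} {w : Vec Link n} → Path m a k w →
                Linked (λ a b → ¬ Opposite a b) (a ∷ w)
  path-linked (end _)     = [-]
  path-linked (goU _ o p) = o ∷ path-linked p
  path-linked (goD _ o p) = o ∷ path-linked p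
  path-linked (goR _ o p) = o ∷ path-linked p

  path-valid : ∀ {m a n} {w : Vec Link n} → Path m a 0 w → IsPosition m w
  path-valid p = record { inStrip    = path-inStrip p
                        ; noReversal = Linked.tail (path-linked p) }

  toList-++⁺ : ∀ as (bs : List⁺ Link) → toList (as ++⁺ bs) ≡ as List.++ toList bs
  toList-++⁺ []       bs = refl
  toList-++⁺ (a ∷ as) bs = cong (a ∷_) (toList-++⁺ as bs)

  prefix-[] : ∀ n bs → prefix n [] bs ≡ prefix n (toList bs) bs
  prefix-[] zero    bs = refl
  prefix-[] (suc n) bs = refl

  module _ (m : ℕ) where

    mutual
      ups : ∀ n i k {a} → i + k ≡ m → ¬ Opposite a u → ¬ Opposite a r →
            Path m a k (prefix n (List.replicate i u List.++ r ∷ (List.replicate m d List.++ r ∷ [])) (block m))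
      ups zero    i       k refl _ _ = end (m≤n+m k i)
      ups (suc n) zero    k refl _ o = goR ≤-refl o (downs n m ≤-refl (λ ()) (λ ()))
      ups (suc n) (suc i) k eq   o _ =
        goU (≤-trans (m≤n+m k (suc i)) (≤-reflexive eq)) o
            (ups n i (suc k) (trans (+-suc i k) eq) (λ ()) (λ ()))

      downs : ∀ n j {a} → j ≤ m → ¬ Opposite a d → ¬ Opposite a r →
              Path m a j (prefix n (List.replicate j d List.++ r ∷ []) (block m))
      downs zero    j       j≤m _ _ = end j≤m
      downs (suc n) zero    j≤m _ o = goR z≤n o (blocks n)
      downs (suc n) (suc j) j≤m o _ =
        goD j≤m o (downs n j (≤-trans (n≤1+n j) j≤m) (λ ()) (λ ()))

      blocks : ∀ n → Path m r 0 (prefix n [] (block m))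
      blocks n = subst (Path m r 0) (sym (trans (prefix-[] n (block m))
                   (cong (λ as → prefix n as (block m)) (toList-++⁺ (List.replicate m u) _))))
                   (ups n m 0 (+-identityʳ m) (λ ()) (λ ()))

    shifted : 1 ≤ m → ∀ n → Path m r 0 (L⁺-word m n)
    shifted 1≤m 0 = end z≤n
    shifted 1≤m 1 = goU z≤n (λ ()) (end 1≤m)
    shifted 1≤m 2 = goU z≤n (λ ()) (goR 1≤m (λ ()) (end 1≤m))
    shifted 1≤m 3 = goU z≤n (λ ()) (goR 1≤m (λ ()) (goD 1≤m (λ ()) (end z≤n)))
    shifted 1≤m (suc (suc (suc (suc n)))) =
      goU z≤n (λ ()) (goR 1≤m (λ ()) (goD 1≤m (λ ()) (goR z≤n (λ ()) (blocks n))))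

    flat : ∀ n → Path m r 0 (H-word m n)
    flat zero    = end z≤n
    flat (suc n) = goR z≤n (λ ()) (flat n)

L : ∀ m n → Position m n
L m n = position (L-word m n) (path-valid (blocks m n))

-- For m = 0 the word starts with u and leaves the strip.
L⁺ : ∀ m n → 1 ≤ m → Position m n
L⁺ m n 1≤m = position (L⁺-word m n) (path-valid (shifted m 1≤m n))

H : ∀ m n → Position m n
H m n = position (H-word m n) (path-valid (flat m n))

------------------------------------------------------------------------
-- The numbers in the distance formulas

s : ℕ → ℕ
s n = suc n C 2

-- n = (m + 1) k + ρ with 0 ≤ ρ ≤ m
z : ℕ → ℕ → ℕ
z m n = (ρ + 1) * k + (k C 2) * (m + 1)
  where
  k = n / suc m
  ρ = n % suc m

{-# OPTIONS --safe #-}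
-- A position is determined by its vertical links; weigh each by the number of
-- moves needed to bring it in through the free end. A move changes one weight by
-- one, or creates or destroys the last vertical link with weight 1, so the
-- directions of the vertical links behave like a stack. Hence the distance of two
-- positions is the sum of the weight differences over the longest common pattern
-- of directions plus all weights beyond it: this function changes by at most one
-- along an edge, and one of two distinct positions can always be moved closer to
-- the other. The diameter bound follows by looking at the second vertical links.
-- If they point in opposite directions, greedy continuations give  L  and  L⁺ ; if
-- one is missing, the extreme case is  L  and  H , which wins for n < 6.
-- If they agree, so many weights cancel that, by convexity of the greedy weight in
-- the length, nothing is gained.
module Submission where

open import Defs
open import Data.Bool.Base using (if_then_else_)
open import Data.Integer.Base using (ℤ; +_; _-_; _⊖_; 0ℤ; +≤+) renaming (_+_ to _+ℤ_; _≤_ to _≤ℤ_)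
import Data.Integer.Properties as ℤ
open import Data.List.Base using (List; []; _∷_; _++_; replicate)
open import Data.List.NonEmpty.Base using (_∷_; _++⁺_; toList)
open import Data.Nat.Base using (ℕ; zero; suc; pred; _+_; _*_; _∸_; _≤_; _<_; z≤n; s≤s; s≤s⁻¹; ∣_-_∣)
open import Data.Nat.Combinatorics using (_C_; nCk+nC[k+1]≡[n+1]C[k+1]; nC1≡n)
open import Data.Nat.DivMod using (_/_; _%_; m≡m%n+[m/n]*n; m%n<n)
open import Data.Nat.Properties
open import Data.Nat.Tactic.RingSolver using (solve-∀)
open import Data.Product.Base using (_×_; _,_; proj₁; proj₂; ∃-syntax)
open import Data.Sum.Base using (_⊎_; inj₁; inj₂) renaming (map to map⊎)
open import Data.Vec.Base using (Vec; []; _∷_)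
open import Data.Vec.Relation.Unary.All using (All; []; _∷_; all?)
open import Data.Vec.Relation.Unary.Linked as Linked using (Linked; []; [-]; _∷_; linked?)
open import Relation.Binary.Definitions using (DecidableEquality)
open import Relation.Binary.PropositionalEquality
open import Relation.Nullary
open import Relation.Nullary.Decidable using (map′; ¬?; _×-dec_; from-yes)

-- Graph distance from a function on pairs of vertices

module Geodesics {V : Set} {_∼_ : V → V → Set} where

  open Graph _∼_

  _▷_ : ∀ {x y z k} → Walk x y k → y ∼ z → Walk x z (suc k)
  nil      ▷ e = step e nil
  step f p ▷ e = step f (p ▷ e)

  module _ (δ : V → V → ℕ) (δ-refl : ∀ x → δ x x ≡ 0)
           (δ-edge : ∀ {x y} z → x ∼ y → δ x z ≤ suc (δ y z))
           (closer : ∀ x y → x ≡ y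
                           ⊎ (∃[ z ] x ∼ z × suc (δ z y) ≡ δ x y)
                           ⊎ (∃[ z ] z ∼ y × suc (δ x z) ≡ δ x y))
           where

    δ≤length : ∀ {x y l} → Walk x y l → δ x y ≤ l
    δ≤length {x} nil          = ≤-reflexive (δ-refl x)
    δ≤length {y = y} (step e p) = ≤-trans (δ-edge y e) (s≤s (δ≤length p))

    -- Induction on the value of `δ`. As `closer` may move either endpoint, the walk is assembled
    -- from both ends; edges at the far end are appended by `_▷_`.
    geodesic : ∀ k x y → δ x y ≡ k → Walk x y k
    geodesic k x y eq with closer x y
    geodesic k x .x eq | inj₁ refl = subst (Walk x x) (trans (sym (δ-refl x)) eq) nil
    geodesic zero x y eq | inj₂ (inj₁ (z , e , eq′)) = contradiction (trans eq′ eq) λ ()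
    geodesic (suc k) x y eq | inj₂ (inj₁ (z , e , eq′)) =
      step e (geodesic k z y (suc-injective (trans eq′ eq)))
    geodesic zero x y eq | inj₂ (inj₂ (z , e , eq′)) = contradiction (trans eq′ eq) λ ()
    geodesic (suc k) x y eq | inj₂ (inj₂ (z , e , eq′)) =
      geodesic k x z (suc-injective (trans eq′ eq)) ▷ e

    isDistance : ∀ x y → IsDistance x y (δ x y)
    isDistance x y = geodesic _ x y refl , λ _ → δ≤length

-- Links and the symmetry of moves

_≟ˡ_ : DecidableEquality Link
u ≟ˡ u = yes refl
u ≟ˡ d = no λ ()
u ≟ˡ r = no λ ()
d ≟ˡ u = no λ ()
d ≟ˡ d = yes refl
d ≟ˡ r = no λ ()
r ≟ˡ u = no λ ()
r ≟ˡ d = no λ ()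
r ≟ˡ r = yes refl

opposite? : ∀ a b → Dec (Opposite a b)
opposite? u d = yes ud
opposite? d u = yes du
opposite? u u = no λ ()
opposite? u r = no λ ()
opposite? d d = no λ ()
opposite? d r = no λ ()
opposite? r _ = no λ ()

⟂-sym : ∀ {a b} → a ⟂ b → b ⟂ a
⟂-sym u⟂r = r⟂u
⟂-sym d⟂r = r⟂d
⟂-sym r⟂u = u⟂r
⟂-sym r⟂d = d⟂r

move-sym : ∀ {n} {v w : Vec Link n} → Move v w → Move w v
move-sym (switch o) = switch (⟂-sym o)
move-sym (flip o)   = flip (⟂-sym o)
move-sym (later e)  = later (move-sym e)

-- Weighted vertical links and their distance

verticals : ∀ {n} → Vec Link n → List (Link × ℕ)
verticals []              = []
verticals {suc n} (u ∷ w) = (u , suc n) ∷ verticals w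
verticals {suc n} (d ∷ w) = (d , suc n) ∷ verticals w
verticals (r ∷ w)         = verticals w

verticals-∷ : ∀ {n c} (w : Vec Link n) → c ⟂ r → verticals (c ∷ w) ≡ (c , suc n) ∷ verticals w
verticals-∷ w u⟂r = refl
verticals-∷ w d⟂r = refl

total : List (Link × ℕ) → ℕ
total []             = 0
total ((_ , x) ∷ xs) = x + total xs

-- Only the last vertical link can be created or destroyed, so links beyond the
-- longest common sign pattern have to leave through the free end.
dist : List (Link × ℕ) → List (Link × ℕ) → ℕ
dist []             ys = total ys
dist xs@(_ ∷ _)     [] = total xs
dist ((a , x) ∷ xs) ((b , y) ∷ ys) =
  if does (a ≟ˡ b) then ∣ x - y ∣ + dist xs ys else (x + total xs) + (y + total ys)

dist-∷ : ∀ a x y xs ys → dist ((a , x) ∷ xs) ((a , y) ∷ ys) ≡ ∣ x - y ∣ + dist xs ys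
dist-∷ a x y xs ys with a ≟ˡ a
... | yes _  = refl
... | no a≢a = contradiction refl a≢a

dist-refl : ∀ xs → dist xs xs ≡ 0
dist-refl []             = refl
dist-refl ((a , x) ∷ xs) =
  trans (dist-∷ a x x xs xs) (cong₂ _+_ (∣n-n∣≡0 x) (dist-refl xs))

dist-sym : ∀ xs ys → dist xs ys ≡ dist ys xs
dist-sym []       []      = refl
dist-sym []       (_ ∷ _) = refl
dist-sym (_ ∷ _)  []      = refl
dist-sym ((a , x) ∷ xs) ((b , y) ∷ ys) with a ≟ˡ b | b ≟ˡ a
... | yes refl | yes _  = cong₂ _+_ (∣-∣-comm x y) (dist-sym xs ys)
... | yes refl | no b≢a = contradiction refl b≢a
... | no a≢b   | yes refl = contradiction refl a≢b
... | no _     | no _   = +-comm (x + total xs) (y + total ys)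

data Apart : List (Link × ℕ) → List (Link × ℕ) → Set where
  []ˡ    : ∀ {ys} → Apart [] ys
  []ʳ    : ∀ {xs} → Apart xs []
  differ : ∀ {a b x y xs ys} → a ≢ b → Apart ((a , x) ∷ xs) ((b , y) ∷ ys)

dist-apart : ∀ {xs ys} → Apart xs ys → dist xs ys ≡ total xs + total ys
dist-apart []ˡ = refl
dist-apart {[]} []ʳ = refl
dist-apart {_ ∷ _} []ʳ = sym (+-identityʳ _)
dist-apart (differ {a} {b} a≢b) with a ≟ˡ b
... | yes a≡b = contradiction a≡b a≢b
... | no _    = refl

-- The trace of one move, oriented so that the total weight rises: a switch changes one weight, a
-- flip creates a last link of weight 1.
data Shift : List (Link × ℕ) → List (Link × ℕ) → Set where
  grow  : ∀ {a} → Shift [] ((a , 1) ∷ [])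
  raise : ∀ {a x xs} → Shift ((a , x) ∷ xs) ((a , suc x) ∷ xs)
  later : ∀ {v xs ys} → Shift xs ys → Shift (v ∷ xs) (v ∷ ys)

total-shift : ∀ {xs ys} → Shift xs ys → total ys ≡ suc (total xs)
total-shift grow = refl
total-shift raise = refl
total-shift (later {_ , x} σ) = trans (cong (λ t → x + t) (total-shift σ)) (+-suc x _)

-- Losing weight cannot create agreement, whereas gaining can: a link added to an empty list may
-- match the other list.
apart-shift : ∀ {xs ys zs} → Shift xs ys → Apart ys zs → Apart xs zs
apart-shift _         []ʳ        = []ʳ
apart-shift grow      (differ _) = []ˡ
apart-shift raise     (differ o) = differ o
apart-shift (later _) (differ o) = differ o

dist-shift-apart : ∀ {xs ys zs} → Shift xs ys → Apart ys zs →
                   suc (dist xs zs) ≡ dist ys zs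
dist-shift-apart {xs} {ys} {zs} σ o = begin
  suc (dist xs zs)            ≡⟨ cong suc (dist-apart (apart-shift σ o)) ⟩
  suc (total xs) + total zs   ≡⟨ cong (_+ total zs) (sym (total-shift σ)) ⟩
  total ys + total zs         ≡⟨ sym (dist-apart o) ⟩
  dist ys zs                  ∎
  where open ≡-Reasoning

Near : ℕ → ℕ → Set
Near p q = p ≤ suc q × q ≤ suc p

near-suc : ∀ {p q} → q ≡ suc p → Near p q
near-suc {p} refl = m≤n⇒m≤1+n (n≤1+n p) , ≤-refl

near-+ : ∀ c {p q} → Near p q → Near (c + p) (c + q)
near-+ c (p≤ , q≤) = ≤-trans (+-monoʳ-≤ c p≤) (≤-reflexive (+-suc c _))
                   , ≤-trans (+-monoʳ-≤ c q≤) (≤-reflexive (+-suc c _))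

near-∣-∣ : ∀ x y c → Near (∣ x - y ∣ + c) (∣ suc x - y ∣ + c)
near-∣-∣ x       zero    c rewrite ∣-∣-identityʳ x = near-suc refl
near-∣-∣ zero    (suc y) c = ≤-refl , m≤n⇒m≤1+n (n≤1+n _)
near-∣-∣ (suc x) (suc y) c = near-∣-∣ x y c

dist-shift : ∀ {xs ys} zs → Shift xs ys → Near (dist xs zs) (dist ys zs)
dist-shift {xs} {ys} [] σ
  rewrite dist-sym xs [] | dist-sym ys [] = near-suc (total-shift σ)
dist-shift ((b , z) ∷ zs) (grow {a}) with a ≟ˡ b
-- Here the empty list acts like a link of direction `b` with weight 0.
... | yes _ = near-∣-∣ 0 z (total zs)
... | no _  = near-suc refl
dist-shift ((b , z) ∷ zs) (raise {a} {x} {xs}) with a ≟ˡ b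
... | yes _ = near-∣-∣ x z (dist xs zs)
... | no _  = near-suc refl
dist-shift ((b , z) ∷ zs) (later {a , x} {xs} σ) with a ≟ˡ b
... | yes _ = near-+ ∣ x - z ∣ (dist-shift zs σ)
... | no _  = near-suc (cong (λ t → t + (z + total zs)) (total-shift (later {a , x} σ)))

shift-∷ : ∀ {n} {v w : Vec Link n} a → Shift (verticals v) (verticals w) →
          Shift (verticals (a ∷ v)) (verticals (a ∷ w))
shift-∷ u = later
shift-∷ d = later
shift-∷ r σ = σ

shift-move : ∀ {n} {v w : Vec Link n} → Move v w →
             Shift (verticals v) (verticals w) ⊎ Shift (verticals w) (verticals v)
shift-move (switch u⟂r) = inj₂ raise
shift-move (switch d⟂r) = inj₂ raise
shift-move (switch r⟂u) = inj₁ raise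
shift-move (switch r⟂d) = inj₁ raise
shift-move (flip u⟂r)   = inj₂ grow
shift-move (flip d⟂r)   = inj₂ grow
shift-move (flip r⟂u)   = inj₁ grow
shift-move (flip r⟂d)   = inj₁ grow
shift-move (later {a = a} e) = map⊎ (shift-∷ a) (shift-∷ a) (shift-move e)

dist-move : ∀ {n} {v w : Vec Link n} zs → Move v w →
            dist (verticals v) zs ≤ suc (dist (verticals w) zs)
dist-move zs e with shift-move e
... | inj₁ σ = proj₁ (dist-shift zs σ)
... | inj₂ σ = proj₂ (dist-shift zs σ)

-- Positions as paths with natural heights

-- Climb a k j k′ j′: the link a leads from height k with headroom j to height
-- k′ with headroom j′.
data Climb : Link → ℕ → ℕ → ℕ → ℕ → Set where
  up    : ∀ {k j} → Climb u k (suc j) (suc k) j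
  down  : ∀ {k j} → Climb d (suc k) j k (suc j)
  level : ∀ {k j} → Climb r k j k j

-- Path a k j w: the word w can follow the letter a at height k with headroom j.
data Path (a : Link) : ℕ → ℕ → ∀ {n} → Vec Link n → Set where
  end  : ∀ {k j} → Path a k j []
  link : ∀ {k j k′ j′ b n} {w : Vec Link n} → ¬ Opposite a b →
         Climb b k j k′ j′ → Path b k′ j′ w → Path a k j (b ∷ w)

InStrip : ℕ → ℤ → Set
InStrip m y = (0ℤ ≤ℤ y) × (y ≤ℤ + m)

climb-sum : ∀ {a k j k′ j′} → Climb a k j k′ j′ → k′ + j′ ≡ k + j
climb-sum up    = sym (+-suc _ _)
climb-sum down  = +-suc _ _
climb-sum level = refl

climb-rise : ∀ {a k j k′ j′} → Climb a k j k′ j′ → + k′ ≡ + k +ℤ rise a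
climb-rise {k = k} up = cong +_ (+-comm 1 k)
climb-rise down       = refl
climb-rise level      = sym (ℤ.+-identityʳ _)

path-inStrip : ∀ {m a k j n} {w : Vec Link n} → k + j ≡ m → Path a k j w →
               All (InStrip m) (heights (+ k) w)
path-inStrip {k = k} {j} refl end = (+≤+ z≤n , +≤+ (m≤m+n k j)) ∷ []
path-inStrip {m} {k = k} {j} {w = _ ∷ w} refl (link _ c p) =
  (+≤+ z≤n , +≤+ (m≤m+n k j)) ∷
  subst (λ y → All (InStrip m) (heights y w)) (climb-rise c) (path-inStrip (climb-sum c) p)

path-linked : ∀ {a k j n} {w : Vec Link n} → Path a k j w →
              Linked (λ b c → ¬ Opposite b c) (a ∷ w)
path-linked end          = [-]
path-linked (link o _ p) = o ∷ path-linked p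

path-valid : ∀ {m a n} {w : Vec Link n} → Path a 0 m w → IsPosition m w
path-valid p = record { inStrip    = path-inStrip refl p
                      ; noReversal = Linked.tail (path-linked p) }

start-inStrip : ∀ {m y n} (w : Vec Link n) → All (InStrip m) (heights y w) → InStrip m y
start-inStrip []      (i ∷ _) = i
start-inStrip (_ ∷ _) (i ∷ _) = i

toPath : ∀ {m a k j n} (w : Vec Link n) → k + j ≡ m → All (InStrip m) (heights (+ k) w) →
         Linked (λ b c → ¬ Opposite b c) (a ∷ w) → Path a k j w
toPath [] _ _ _ = end
toPath {k = k} {zero} (u ∷ w) refl (_ ∷ h) _ =
  contradiction (ℤ.drop‿+≤+ (proj₂ (start-inStrip w h))) (<⇒≱ (+-monoʳ-< k (s≤s z≤n)))
toPath {m} {k = k} {suc j} (u ∷ w) eq (_ ∷ h) (o ∷ l) =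
  link o up (toPath w (trans (sym (+-suc k j)) eq)
    (subst (λ y → All (InStrip m) (heights y w)) (sym (climb-rise {j = suc j} up)) h) l)
toPath {k = zero} (d ∷ w) _ (_ ∷ h) _ = contradiction (proj₁ (start-inStrip w h)) λ ()
toPath {k = suc k} {j} (d ∷ w) refl (_ ∷ h) (o ∷ l) = link o down (toPath w (+-suc k j) h l)
toPath {m} {k = k} {j} (r ∷ w) eq (_ ∷ h) (o ∷ l) =
  link o level (toPath w eq
    (subst (λ y → All (InStrip m) (heights y w)) (ℤ.+-identityʳ (+ k)) h) l)

-- Decidability allows `path` to recover the irrelevant field `valid` through `recompute`.
isPosition? : ∀ m {n} (w : Vec Link n) → Dec (IsPosition m w)
isPosition? m w = map′
  (λ (h , l) → record { inStrip = h ; noReversal = l })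
  (λ v → IsPosition.inStrip v , IsPosition.noReversal v)
  (all? (λ y → (0ℤ ℤ.≤? y) ×-dec (y ℤ.≤? + m)) (heights 0ℤ w)
    ×-dec linked? (λ a b → ¬? (opposite? a b)) w)

-- The arm may be imagined to be preceded by a horizontal link.
linked-r∷ : ∀ {n} {w : Vec Link n} → Linked (λ b c → ¬ Opposite b c) w →
            Linked (λ b c → ¬ Opposite b c) (r ∷ w)
linked-r∷ {w = []}    _ = [-]
linked-r∷ {w = _ ∷ _} l = (λ ()) ∷ l

path : ∀ {m n} (p : Position m n) → Path r 0 m (word p)
path {m} (position w v) =
  toPath w refl (IsPosition.inStrip v′) (linked-r∷ (IsPosition.noReversal v′))
  where v′ = recompute (isPosition? m w) v

-- Spacing of consecutive vertical links

-- Room c n xs: xs can follow the vertical link c of weight suc n.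
data Room (c : Link) (n : ℕ) : List (Link × ℕ) → Set where
  none : Room c n []
  some : ∀ {b y ys} → y ≤ n → (Opposite c b → y < n) → Room c n ((b , y) ∷ ys)

data Chain : List (Link × ℕ) → Set where
  []  : Chain []
  _∷_ : ∀ {c n ys} → Room c n ys → Chain ys → Chain ((c , suc n) ∷ ys)

room-r : ∀ {a n xs} → Room r n xs → Room a (suc n) xs
room-r none         = none
room-r (some y≤n _) = some (m≤n⇒m≤1+n y≤n) (λ _ → s≤s y≤n)

room : ∀ {a k j n} {w : Vec Link n} → Path a k j w → Room a n (verticals w)
room end                    = none
room (link {b = u} o _ _)   = some ≤-refl (λ q → contradiction q o)
room (link {b = d} o _ _)   = some ≤-refl (λ q → contradiction q o)
room (link {b = r} _ _ p)   = room-r (room p)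

chain : ∀ {a k j n} {w : Vec Link n} → Path a k j w → Chain (verticals w)
chain end                  = []
chain (link {b = u} _ _ p) = room p ∷ chain p
chain (link {b = d} _ _ p) = room p ∷ chain p
chain (link {b = r} _ _ p) = chain p

relink : ∀ {a c k j n} {w : Vec Link n} → Path a k j w → Room c n (verticals w) → Path c k j w
relink end _ = end
relink (link {b = u} _ s p) (some _ g) = link (λ q → <-irrefl refl (g q)) s p
relink (link {b = d} _ s p) (some _ g) = link (λ q → <-irrefl refl (g q)) s p
relink (link {b = r} _ s p) _          = link (λ ()) s p

-- Putting `r` first visits no new height, so the strip is respected. Only a reversal between `c`
-- and the first link of `w` could arise, and `Room` excludes it.
slide : ∀ {a c k j n} {w : Vec Link n} → Path a k j (c ∷ r ∷ w) →
        Room c n (verticals w) → Path a k j (r ∷ c ∷ w)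
slide (link _ s (link _ level p)) g = link (λ ()) level (link (λ ()) s (relink p g))

-- Moves that decrease the distance

Retract : Link → ℕ → ℕ → ∀ {n} → Vec Link n → Set
Retract a k j x = ∃[ z ] Move x z × Path a k j z × Shift (verticals z) (verticals x)

Retreat : Link → ℕ → ℕ → ∀ {n} → Vec Link n → List (Link × ℕ) → Set
Retreat a k j x ys =
  ∃[ z ] Move x z × Path a k j z × suc (dist (verticals z) ys) ≡ dist (verticals x) ys

[]? : (xs : List (Link × ℕ)) → Dec (xs ≡ [])
[]? []      = yes refl
[]? (_ ∷ _) = no λ ()

shift-flip : ∀ {c} → c ⟂ r → Shift [] (verticals (c ∷ []))
shift-flip u⟂r = grow
shift-flip d⟂r = grow

shift-switch : ∀ {c n} (w : Vec Link n) → c ⟂ r →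
               Shift (verticals (r ∷ c ∷ w)) (verticals (c ∷ r ∷ w))
shift-switch w u⟂r = raise
shift-switch w d⟂r = raise

retract-∷ : ∀ {a b k j k′ j′ n} {w : Vec Link n} → ¬ Opposite a b → Climb b k j k′ j′ →
            Retract b k′ j′ w → Retract a k j (b ∷ w)
retract-∷ {b = b} o s (z , e , q , σ) = b ∷ z , later e , link o s q , shift-∷ b σ

retract-r : ∀ {a c k j k′ j′ n} {w : Vec Link n} → c ⟂ r → ¬ Opposite a c →
            Climb c k j k′ j′ → Path c k′ j′ (r ∷ w) →
            (verticals w ≢ [] → Retract c k′ j′ (r ∷ w)) → Retract a k j (c ∷ r ∷ w)
retract-r {c = c} {w = w} c⟂r o s p rec with []? (verticals w)
... | yes eq = r ∷ c ∷ w , switch c⟂r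
             , slide (link o s p) (subst (Room c _) (sym eq) none) , shift-switch w c⟂r
... | no ne  = retract-∷ o s (rec ne)

mutual

  -- The last vertical link is never blocked: all links behind it are horizontal, so it can be
  -- switched with its successor or, at the free end, flipped.
  retract : ∀ {a k j n} {x : Vec Link n} → Path a k j x → verticals x ≢ [] → Retract a k j x
  retract end                      ne = contradiction refl ne
  retract (link {b = u} o s p)     _  = retractᵛ u⟂r o s p
  retract (link {b = d} o s p)     _  = retractᵛ d⟂r o s p
  retract (link {b = r} o s p)     ne = retract-∷ o s (retract p ne)

  retractᵛ : ∀ {a c k j k′ j′ n} {w : Vec Link n} → c ⟂ r → ¬ Opposite a c →
             Climb c k j k′ j′ → Path c k′ j′ w → Retract a k j (c ∷ w)
  retractᵛ c⟂r o s end = r ∷ [] , flip c⟂r , link (λ ()) level end , shift-flip c⟂r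
  retractᵛ c⟂r o s p@(link {b = u} _ _ _) = retract-∷ o s (retract p λ ())
  retractᵛ c⟂r o s p@(link {b = d} _ _ _) = retract-∷ o s (retract p λ ())
  retractᵛ c⟂r o s p@(link {b = r} _ _ _) = retract-r c⟂r o s p (retract p)

retreat-apart : ∀ {a k j n} {x : Vec Link n} {ys} → Path a k j x → verticals x ≢ [] →
                Apart (verticals x) ys → Retreat a k j x ys
retreat-apart p ne o =
  let z , e , q , σ = retract p ne in z , e , q , dist-shift-apart σ o

dist-later : ∀ a x y {xs xs′ ys} → suc (dist xs′ ys) ≡ dist xs ys →
             suc (dist ((a , x) ∷ xs′) ((a , y) ∷ ys)) ≡ dist ((a , x) ∷ xs) ((a , y) ∷ ys)
dist-later a x y {xs} {xs′} {ys} eq = begin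
  suc (dist ((a , x) ∷ xs′) ((a , y) ∷ ys)) ≡⟨ cong suc (dist-∷ a x y xs′ ys) ⟩
  suc (∣ x - y ∣ + dist xs′ ys)             ≡⟨ sym (+-suc ∣ x - y ∣ _) ⟩
  ∣ x - y ∣ + suc (dist xs′ ys)             ≡⟨ cong (λ t → ∣ x - y ∣ + t) eq ⟩
  ∣ x - y ∣ + dist xs ys                    ≡⟨ sym (dist-∷ a x y xs ys) ⟩
  dist ((a , x) ∷ xs) ((a , y) ∷ ys)        ∎
  where open ≡-Reasoning

∣suc-∣ : ∀ {x y} → y ≤ x → ∣ suc x - y ∣ ≡ suc ∣ x - y ∣
∣suc-∣ {x} z≤n   = cong suc (sym (∣-∣-identityʳ x))
∣suc-∣ (s≤s y≤x) = ∣suc-∣ y≤x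

dist-raise : ∀ a {x y} xs ys → y ≤ x →
             suc (dist ((a , x) ∷ xs) ((a , y) ∷ ys)) ≡ dist ((a , suc x) ∷ xs) ((a , y) ∷ ys)
dist-raise a {x} {y} xs ys y≤x = begin
  suc (dist ((a , x) ∷ xs) ((a , y) ∷ ys)) ≡⟨ cong suc (dist-∷ a x y xs ys) ⟩
  suc ∣ x - y ∣ + dist xs ys               ≡⟨ cong (_+ dist xs ys) (sym (∣suc-∣ y≤x)) ⟩
  ∣ suc x - y ∣ + dist xs ys               ≡⟨ sym (dist-∷ a (suc x) y xs ys) ⟩
  dist ((a , suc x) ∷ xs) ((a , y) ∷ ys)   ∎
  where open ≡-Reasoning

retreat-later : ∀ {a b k j k′ j′ n y ys} {w : Vec Link n} → b ⟂ r → ¬ Opposite a b →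
                Climb b k j k′ j′ → Retreat b k′ j′ w ys → Retreat a k j (b ∷ w) ((b , y) ∷ ys)
retreat-later {n = n} {y} {w = w} u⟂r o s (z , e , q , eq) =
  u ∷ z , later e , link o s q , dist-later u (suc n) y {verticals w} {verticals z} eq
retreat-later {n = n} {y} {w = w} d⟂r o s (z , e , q , eq) =
  d ∷ z , later e , link o s q , dist-later d (suc n) y {verticals w} {verticals z} eq

retreat-switch : ∀ {a c k j n y ys} {w : Vec Link n} → c ⟂ r → Path a k j (c ∷ r ∷ w) →
                 Room c n (verticals w) → y ≤ suc n → Retreat a k j (c ∷ r ∷ w) ((c , y) ∷ ys)
retreat-switch {w = w} u⟂r p g y≤ =
  r ∷ u ∷ w , switch u⟂r , slide p g , dist-raise u (verticals w) _ y≤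
retreat-switch {w = w} d⟂r p g y≤ =
  r ∷ d ∷ w , switch d⟂r , slide p g , dist-raise d (verticals w) _ y≤

-- The last link of the common sign pattern that is ahead of its target is free
-- to move, because the link after it is not ahead of its own target.
mutual

  advance : ∀ {a c k j n x′ y xs ys} {x : Vec Link n} → Path a k j x →
            verticals x ≡ (c , suc x′) ∷ xs → y ≤ x′ → Chain ((c , y) ∷ ys) →
            Retreat a k j x ((c , y) ∷ ys)
  advance (link {b = u} o s p) refl y≤ C = advanceᵛ u⟂r o s p y≤ C
  advance (link {b = d} o s p) refl y≤ C = advanceᵛ d⟂r o s p y≤ C
  advance (link {b = r} o s p) eq   y≤ C =
    let z , e , q , eq′ = advance p eq y≤ C in r ∷ z , later e , link o s q , eq′

  advanceᵛ : ∀ {a c k j k′ j′ n y ys} {w : Vec Link n} → c ⟂ r → ¬ Opposite a c →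
             Climb c k j k′ j′ → Path c k′ j′ w → y ≤ n → Chain ((c , y) ∷ ys) →
             Retreat a k j (c ∷ w) ((c , y) ∷ ys)
  advanceᵛ c⟂r o s p (s≤s y≤n) (R ∷ C) with advance-tail p refl y≤n R C
  ... | inj₂ t = retreat-later c⟂r o s t
  -- A vertical link right behind `c` would be too heavy for `Room`; so the next link is horizontal
  -- and the switch is available.
  advanceᵛ c⟂r o s (link {b = u} _ _ _) _ _ | inj₁ (some n<n _) = contradiction n<n (<-irrefl refl)
  advanceᵛ c⟂r o s (link {b = d} _ _ _) _ _ | inj₁ (some n<n _) = contradiction n<n (<-irrefl refl)
  advanceᵛ c⟂r o s p@(link {b = r} _ _ _) y≤n _ | inj₁ g = retreat-switch c⟂r (link o s p) g y≤n

  advance-tail : ∀ {c k j n n′ y xs ys} {w : Vec Link n′} → Path c k j w → verticals w ≡ xs →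
                 y ≤ n → Room c y ys → Chain ys → Room c n xs ⊎ Retreat c k j w ys
  advance-tail {xs = []} _ _ _ _ _ = inj₁ none
  advance-tail {xs = _ ∷ _} {[]} p eq _ _ _ =
    inj₂ (retreat-apart p (λ eq′ → contradiction (trans (sym eq) eq′) λ ()) []ʳ)
  advance-tail {xs = (b , x) ∷ _} {(b′ , y′) ∷ _} p eq y≤n R C with b ≟ˡ b′ | x ≤? y′
  -- The target leaves room for its second link `y′`. Since `x ≤ y′` and `y ≤ n`, this room carries
  -- over to the word, with strictness for opposite directions.
  advance-tail p eq y≤n (some y′≤ g) C | yes refl | yes x≤y′ =
    inj₁ (some (≤-trans x≤y′ (≤-trans y′≤ y≤n)) (λ q → ≤-<-trans x≤y′ (<-≤-trans (g q) y≤n)))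
  advance-tail {xs = (b , suc x) ∷ _} p eq y≤n R C | yes refl | no x≰y′ =
    inj₂ (advance p eq (s≤s⁻¹ (≰⇒> x≰y′)) C)
  advance-tail {xs = (b , zero) ∷ _} p eq y≤n R C | yes refl | no x≰y′ = contradiction z≤n x≰y′
  ... | no b≢b′ | _ =
    inj₂ (retreat-apart p (λ eq′ → contradiction (trans (sym eq) eq′) λ ())
                          (subst (λ xs → Apart xs _) (sym eq) (differ b≢b′)))

vertical? : ∀ b → b ≡ r ⊎ b ⟂ r
vertical? u = inj₂ u⟂r
vertical? d = inj₂ d⟂r
vertical? r = inj₁ refl

vertical-≢[] : ∀ {n c} {w : Vec Link n} → c ⟂ r → verticals (c ∷ w) ≢ []
vertical-≢[] u⟂r ()
vertical-≢[] d⟂r ()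

apart-∷ : ∀ {b n x xs} {w : Vec Link n} {c} → c ⟂ r → c ≢ b → Apart (verticals (c ∷ w)) ((b , x) ∷ xs)
apart-∷ u⟂r c≢b = differ c≢b
apart-∷ d⟂r c≢b = differ c≢b

-- By `Room r n xs` the first target has weight at most `n`, less than that of `c`; so `c` is ahead,
-- or the directions differ.
retreat-vertical : ∀ {a c k j k′ j′ n xs} {w : Vec Link n} → c ⟂ r → ¬ Opposite a c →
                   Climb c k j k′ j′ → Path c k′ j′ w → Room r n xs → Chain xs →
                   Retreat a k j (c ∷ w) xs
retreat-vertical {w = w} c⟂r o s p none _ =
  retreat-apart (link o s p) (vertical-≢[] {w = w} c⟂r) []ʳ
retreat-vertical {c = c} {w = w} c⟂r o s p (some {b} y≤n _) C with c ≟ˡ b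
... | yes refl = advanceᵛ c⟂r o s p y≤n C
... | no c≢b   = retreat-apart (link o s p) (vertical-≢[] {w = w} c⟂r) (apart-∷ {w = w} c⟂r c≢b)

climb-unique : ∀ {b k j k₁ j₁ k₂ j₂} → Climb b k j k₁ j₁ → Climb b k j k₂ j₂ →
               k₁ ≡ k₂ × j₁ ≡ j₂
climb-unique up    up    = refl , refl
climb-unique down  down  = refl , refl
climb-unique level level = refl , refl

retreat-∷ : ∀ {a b k j k′ j′ n} {x y : Vec Link n} → ¬ Opposite a b → Climb b k j k′ j′ →
            Retreat b k′ j′ x (verticals y) → Retreat a k j (b ∷ x) (verticals (b ∷ y))
retreat-∷ {b = u} o s = retreat-later u⟂r o s
retreat-∷ {b = d} o s = retreat-later d⟂r o s
retreat-∷ {b = r} o s (z , e , q , eq) = r ∷ z , later e , link o s q , eq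

-- The common prefix is stripped. At the first difference a vertical link facing a horizontal one is
-- moved back, while two distinct vertical links make the tails `Apart`.
closer : ∀ {a k j n} {x y : Vec Link n} → Path a k j x → Path a k j y →
         x ≡ y ⊎ Retreat a k j x (verticals y) ⊎ Retreat a k j y (verticals x)
closer end end = inj₁ refl
closer (link {b = b} {w = v} o s p) (link {b = c} {w = w} o′ s′ p′) with b ≟ˡ c
... | yes refl with refl , refl ← climb-unique s s′ =
  map⊎ (cong (b ∷_)) (map⊎ (retreat-∷ o s) (retreat-∷ o s)) (closer p p′)
... | no b≢c with vertical? b | vertical? c
...   | inj₁ refl | inj₁ refl = contradiction refl b≢c
...   | inj₁ refl | inj₂ c⟂r  =
  inj₂ (inj₂ (retreat-vertical c⟂r o′ s′ p′ (room p) (chain p)))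
...   | inj₂ b⟂r  | inj₁ refl =
  inj₂ (inj₁ (retreat-vertical b⟂r o s p (room p′) (chain p′)))
...   | inj₂ b⟂r  | inj₂ c⟂r  =
  inj₂ (inj₁ (retreat-apart (link o s p) (vertical-≢[] {w = v} b⟂r)
    (subst (Apart (verticals (b ∷ v))) (sym (verticals-∷ w c⟂r)) (apart-∷ {w = v} b⟂r b≢c))))

-- The graph distance of positions

δ : ∀ {m n} → Position m n → Position m n → ℕ
δ p q = dist (verticals (word p)) (verticals (word q))

position-≡ : ∀ {m n} (p q : Position m n) → word p ≡ word q → p ≡ q
position-≡ (position w _) (position .w _) refl = refl

closer-position : ∀ {m n} (p q : Position m n) →
  p ≡ q ⊎ (∃[ t ] Edge p t × suc (δ t q) ≡ δ p q) ⊎ (∃[ t ] Edge t q × suc (δ p t) ≡ δ p q)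
closer-position p q with closer (path p) (path q)
... | inj₁ eq = inj₁ (position-≡ p q eq)
... | inj₂ (inj₁ (t , e , π , eq)) = inj₂ (inj₁ (position t (path-valid π) , e , eq))
... | inj₂ (inj₂ (t , e , π , eq)) = inj₂ (inj₂ (position t (path-valid π) , move-sym e , (begin
  suc (dist vp vt) ≡⟨ cong suc (dist-sym vp vt) ⟩
  suc (dist vt vp) ≡⟨ eq ⟩
  dist vq vp       ≡⟨ dist-sym vq vp ⟩
  dist vp vq       ∎)))
  where
  open ≡-Reasoning
  vp = verticals (word p)
  vq = verticals (word q)
  vt = verticals t

δ-isDistance : ∀ {m n} (p q : Position m n) → G.IsDistance m n p q (δ p q)
δ-isDistance = Geodesics.isDistance δ (λ p → dist-refl (verticals (word p)))
                 (λ q e → dist-move (verticals (word q)) e) closer-position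

-- Estimates for the upper bound

dist≤total : ∀ xs ys → dist xs ys ≤ total xs + total ys
dist≤total []      ys = ≤-refl
dist≤total (_ ∷ _) [] = m≤m+n _ 0
dist≤total ((a , x) ∷ xs) ((b , y) ∷ ys) with a ≟ˡ b
... | no _  = ≤-refl
... | yes _ = begin
  ∣ x - y ∣ + dist xs ys            ≤⟨ +-mono-≤ ∣x-y∣≤x+y (dist≤total xs ys) ⟩
  (x + y) + (total xs + total ys)   ≡⟨ interchange x y (total xs) (total ys) ⟩
  (x + total xs) + (y + total ys)   ∎
  where
  open ≤-Reasoning
  ∣x-y∣≤x+y = ≤-trans (∣m-n∣≤m⊔n x y) (m⊔n≤m+n x y)
  interchange : ∀ a b c e → (a + b) + (c + e) ≡ (a + c) + (b + e)
  interchange = solve-∀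

-- First a k j n xs: the vertical links xs of a word of length n that follows
-- the letter a at height k with headroom j.
data First (a : Link) (k j n : ℕ) : List (Link × ℕ) → Set where
  flat  : First a k j n []
  first : ∀ {c k′ j′ n′} {w : Vec Link n′} → c ⟂ r → Climb c k j k′ j′ → Path c k′ j′ w →
          Room a n ((c , suc n′) ∷ verticals w) → First a k j n ((c , suc n′) ∷ verticals w)

first-r : ∀ {a k j n xs} → First r k j n xs → First a k j (suc n) xs
first-r flat             = flat
first-r (first c⟂r s p R) = first c⟂r s p (room-r R)

firstVertical : ∀ {a k j n} {w : Vec Link n} → Path a k j w → First a k j n (verticals w)
firstVertical end                          = flat
firstVertical π@(link {b = u} _ s p)       = first u⟂r s p (room π)
firstVertical π@(link {b = d} _ s p)       = first d⟂r s p (room π)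
firstVertical (link {b = r} _ level p)     = first-r (firstVertical p)

spread : ∀ {l x y n} → l ≤ x → l ≤ y → x ≤ n → y ≤ n → l + ∣ x - y ∣ ≤ n
spread {l} {x} {y} l≤x l≤y x≤n y≤n with ≤-total x y
... | inj₁ x≤y rewrite m≤n⇒∣m-n∣≡n∸m x≤y =
  ≤-trans (+-monoˡ-≤ (y ∸ x) l≤x) (≤-trans (≤-reflexive (m+[n∸m]≡n x≤y)) y≤n)
... | inj₂ y≤x rewrite m≤n⇒∣n-m∣≡n∸m y≤x =
  ≤-trans (+-monoˡ-≤ (x ∸ y) l≤y) (≤-trans (≤-reflexive (m+[n∸m]≡n y≤x)) x≤n)

increasing⇒mono : ∀ (f : ℕ → ℕ) → (∀ n → f n < f (suc n)) → ∀ {a b} → a ≤ b → f a ≤ f b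
increasing⇒mono f f< {a} {b} a≤b =
  subst (λ b → f a ≤ f b) (m∸n+n≡m a≤b) (go (b ∸ a))
  where
  go : ∀ t → f a ≤ f (t + a)
  go zero    = ≤-refl
  go (suc t) = ≤-trans (go t) (<⇒≤ (f< (t + a)))

increasing⇒gap : ∀ (f : ℕ → ℕ) → (∀ n → f n < f (suc n)) → ∀ {a b} → a ≤ b →
                 ∣ a - b ∣ + f a ≤ f b
increasing⇒gap f f< {a} {b} a≤b rewrite m≤n⇒∣m-n∣≡n∸m a≤b =
  subst (λ c → b ∸ a + f a ≤ f c) (m∸n+n≡m a≤b) (go (b ∸ a))
  where
  go : ∀ t → t + f a ≤ f (t + a)
  go zero    = ≤-refl
  go (suc t) = ≤-trans (s≤s (go t)) (f< (t + a))

s-suc : ∀ n → s (suc n) ≡ suc n + s n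
s-suc n = trans (sym (nCk+nC[k+1]≡[n+1]C[k+1] (suc n) 1)) (cong (_+ s n) (nC1≡n (suc n)))

-- Greedy words and the maximal total weight

-- For v vertical, best m n i, count m n i and rest m n i are the weight of the vertical
-- links, their number and the weight of the horizontal links among the first
-- n letters of  vⁱ r vᵐ r vᵐ r ⋯
module Greedy (m : ℕ) where

  best count rest : ℕ → ℕ → ℕ

  best zero    i       = 0
  best (suc n) zero    = best n m
  best (suc n) (suc i) = suc n + best n i

  count zero    i       = 0
  count (suc n) zero    = count n m
  count (suc n) (suc i) = suc (count n i)

  rest zero    i       = 0
  rest (suc n) zero    = suc n + rest n m
  rest (suc n) (suc i) = rest n i

  best+rest : ∀ n i → best n i + rest n i ≡ s n
  best+rest zero    i = refl
  best+rest (suc n) zero = begin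
    best n m + (suc n + rest n m) ≡⟨ swap (best n m) (suc n) (rest n m) ⟩
    suc n + (best n m + rest n m) ≡⟨ cong (λ t → suc n + t) (best+rest n m) ⟩
    suc n + s n                   ≡⟨ sym (s-suc n) ⟩
    s (suc n)                     ∎
    where
    open ≡-Reasoning
    swap : ∀ a b c → a + (b + c) ≡ b + (a + c)
    swap = solve-∀
  best+rest (suc n) (suc i) = begin
    suc n + best n i + rest n i   ≡⟨ +-assoc (suc n) (best n i) (rest n i) ⟩
    suc n + (best n i + rest n i) ≡⟨ cong (λ t → suc n + t) (best+rest n i) ⟩
    suc n + s n                   ≡⟨ sym (s-suc n) ⟩
    s (suc n)                     ∎
    where open ≡-Reasoning

  rest-short : ∀ {n i} → n ≤ i → rest n i ≡ 0
  rest-short z≤n       = refl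
  rest-short (s≤s n≤i) = rest-short n≤i

  rest-shift : ∀ i n → rest (i + n) i ≡ rest n 0
  rest-shift zero    n = refl
  rest-shift (suc i) n = rest-shift i n

  -- Cutting off the first `m` vertical letters and the horizontal one after them removes the weight
  -- `suc (ρ + k * suc m)` and leaves the same sum with one block fewer.
  rest-blocks : ∀ ρ k → ρ ≤ m → rest (ρ + k * suc m) m ≡ (ρ + 1) * k + (k C 2) * (m + 1)
  rest-blocks ρ zero ρ≤m rewrite +-identityʳ ρ | *-zeroʳ (ρ + 1) = rest-short ρ≤m
  rest-blocks ρ (suc k) ρ≤m = begin
    rest (ρ + suc k * suc m) m
      ≡⟨ cong (λ n → rest n m) (length ρ k m) ⟩
    rest (m + suc n) m
      ≡⟨ rest-shift m (suc n) ⟩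
    suc n + rest n m
      ≡⟨ cong (λ t → suc n + t) (rest-blocks ρ k ρ≤m) ⟩
    suc n + ((ρ + 1) * k + (k C 2) * (m + 1))
      ≡⟨ collect ρ k m (k C 2) ⟩
    (ρ + 1) * suc k + (k + k C 2) * (m + 1)
      ≡⟨ cong (λ c → (ρ + 1) * suc k + c * (m + 1)) pascal ⟩
    (ρ + 1) * suc k + (suc k C 2) * (m + 1) ∎
    where
    open ≡-Reasoning
    n = ρ + k * suc m
    length : ∀ ρ k m → ρ + suc k * suc m ≡ m + suc (ρ + k * suc m)
    length = solve-∀
    collect : ∀ ρ k m c → suc (ρ + k * suc m) + ((ρ + 1) * k + c * (m + 1)) ≡
                          (ρ + 1) * suc k + (k + c) * (m + 1)
    collect = solve-∀
    pascal : k + k C 2 ≡ suc k C 2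
    pascal = trans (cong (_+ k C 2) (sym (nC1≡n k))) (nCk+nC[k+1]≡[n+1]C[k+1] k 1)

  rest≡z : ∀ n → rest n m ≡ z m n
  rest≡z n = trans (cong (λ n → rest n m) (m≡m%n+[m/n]*n n (suc m)))
                   (rest-blocks (n % suc m) (n / suc m) (s≤s⁻¹ (m%n<n n (suc m))))

  -- One more letter at the end raises the weight of each earlier vertical letter by one and, if
  -- vertical, contributes 1 itself.
  best-suc : ∀ n i → best (suc n) i ≡ best n i + count (suc n) i
  best-suc zero    zero    = refl
  best-suc zero    (suc i) = refl
  best-suc (suc n) zero    = best-suc n m
  best-suc (suc n) (suc i) rewrite best-suc n i = assoc n (best n i) (count (suc n) i)
    where
    assoc : ∀ n b c → suc (suc n) + (b + c) ≡ (suc n + b) + suc c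
    assoc = solve-∀

  best-≤-suc : ∀ n i → best n i ≤ best (suc n) i
  best-≤-suc n i = ≤-trans (m≤m+n _ _) (≤-reflexive (sym (best-suc n i)))

  mutual

    -- `i` is the budget of vertical letters before a forced horizontal one. Joint induction on the
    -- length: a larger budget never hurts, its gain is at most the length (`best-slow`), so a
    -- premature horizontal letter that resets it to `m` never pays (`best-horizontal`).
    best-mono : ∀ n {i i′} → i ≤ i′ → i′ ≤ m → best n i ≤ best n i′
    best-mono zero    _                 _    = z≤n
    best-mono (suc n) {i′ = zero}  z≤n  _    = ≤-refl
    best-mono (suc n) {i′ = suc _} z≤n  i′≤m =
      ≤-trans (best-slow n ≤-refl (<⇒≤ i′≤m)) (n≤1+n _)
    best-mono (suc n) (s≤s i≤i′) i′≤m = +-monoʳ-≤ (suc n) (best-mono n i≤i′ (<⇒≤ i′≤m))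

    best-slow : ∀ n {i i′} → i′ ≤ m → i ≤ m → best n i′ ≤ n + best n i
    best-slow zero    _ _ = z≤n
    best-slow (suc n) {i} {zero} _ i≤m = ≤-trans (best-horizontal n i≤m) (m≤n+m _ (suc n))
    best-slow (suc n) {i} {suc i′} i′<m i≤m =
      +-monoʳ-≤ (suc n) (≤-trans (best-mono n (<⇒≤ i′<m) ≤-refl) (best-horizontal n i≤m))

    best-horizontal : ∀ n {i} → i ≤ m → best n m ≤ best (suc n) i
    best-horizontal n {zero}  _   = ≤-refl
    best-horizontal n {suc i} i<m = ≤-trans (best-slow n ≤-refl (<⇒≤ i<m)) (n≤1+n _)

  -- The budget left after the letter `a`: the way to the wall ahead or, after a horizontal link,
  -- the whole width as a bound for both directions.
  slack : Link → ℕ → ℕ → ℕ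
  slack u k j = j
  slack d k j = k
  slack r k j = k + j

  slack≤m : ∀ a {k j} → k + j ≡ m → slack a k j ≤ m
  slack≤m u {k} {j} refl = m≤n+m j k
  slack≤m d {k} {j} refl = m≤m+n k j
  slack≤m r refl         = ≤-refl

  slack-up : ∀ {a} k j → ¬ Opposite a u → j ≤ slack a k j
  slack-up {u} k j _ = ≤-refl
  slack-up {d} k j o = contradiction du o
  slack-up {r} k j _ = m≤n+m j k

  slack-down : ∀ {a} k j → ¬ Opposite a d → k ≤ slack a k j
  slack-down {u} k j o = contradiction ud o
  slack-down {d} k j _ = ≤-refl
  slack-down {r} k j _ = m≤m+n k j

  -- Greedy words are optimal: a vertical link spends one unit of budget, and `best-horizontal` pays
  -- for the reset by a horizontal link.
  total≤best : ∀ {a k j n} {w : Vec Link n} → k + j ≡ m → Path a k j w →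
               total (verticals w) ≤ best n (slack a k j)
  total≤best eq end = z≤n
  total≤best {a} {n = suc n} eq (link o (up {k} {j}) p) = ≤-trans
    (+-monoʳ-≤ (suc n) (total≤best (trans (climb-sum up) eq) p))
    (best-mono (suc n) (slack-up k (suc j) o) (slack≤m a eq))
  total≤best {a} {n = suc n} eq (link o (down {k} {j}) p) = ≤-trans
    (+-monoʳ-≤ (suc n) (total≤best (trans (climb-sum down) eq) p))
    (best-mono (suc n) (slack-down (suc k) j o) (slack≤m a eq))
  total≤best {a} {n = suc n} eq (link o (level {k} {j}) p) = ≤-trans (total≤best eq p)
    (subst (λ i → best n i ≤ best (suc n) (slack a k j)) (sym eq)
           (best-horizontal n (slack≤m a eq)))

  total≤best-m : ∀ {a k j n} {w : Vec Link n} → k + j ≡ m → Path a k j w →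
                 total (verticals w) ≤ best n m
  total≤best-m {a} {n = n} eq p = ≤-trans (total≤best eq p) (best-mono n (slack≤m a eq) ≤-refl)

  -- The largest weight of the vertical links of a word of length n that starts
  -- with  d  at height 1.
  dip : ℕ → ℕ
  dip zero    = 0
  dip (suc n) = suc n + best n 0

  dip-increasing : ∀ n → dip n < dip (suc n)
  dip-increasing zero    = s≤s z≤n
  dip-increasing (suc n) = s≤s (+-monoʳ-≤ (suc n) (best-≤-suc n 0))

-- Upper bound for the distance by cases on the second vertical links

module Tunnel (m₂ : ℕ) where

  m₁ m : ℕ
  m₁ = suc m₂
  m  = suc m₁

  open Greedy m

  best-increasing : ∀ i n → best n (suc i) < best (suc n) (suc i)
  best-increasing i n = begin-strict
    best n (suc i)                          <⟨ m<m+n (best n (suc i)) (s≤s z≤n) ⟩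
    best n (suc i) + count (suc n) (suc i)  ≡⟨ sym (best-suc n (suc i)) ⟩
    best (suc n) (suc i)                    ∎
    where open ≤-Reasoning

  best-gap : ∀ i {a b} → a ≤ b → ∣ a - b ∣ + best a (suc i) ≤ best b (suc i)
  best-gap i = increasing⇒gap (λ n → best n (suc i)) (best-increasing i)

  best-monoˡ : ∀ i {a b} → a ≤ b → best a (suc i) ≤ best b (suc i)
  best-monoˡ i = increasing⇒mono (λ n → best n (suc i)) (best-increasing i)

  dip-mono : ∀ {a b} → a ≤ b → dip a ≤ dip b
  dip-mono = increasing⇒mono dip dip-increasing

  dip-bound : ∀ {n y} {w : Vec Link n} → Path d 0 m w → suc n < y →
              suc n + total (verticals w) ≤ dip (pred y)
  dip-bound {n} p n<y =
    ≤-trans (+-monoʳ-≤ (suc n) (total≤best refl p)) (dip-mono (pred-mono-≤ n<y))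

  -- `D` stays abstract so that short and long arms share the case analysis. `two` treats opposite
  -- second vertical links, `many` equal ones, and `one`, aided by `two`, a missing one.
  module Bound {n₁ D : ℕ}
    (one  : best (suc n₁) m ≤ D)
    (two  : best n₁ m₁ + dip (pred n₁) ≤ D)
    (many : ∀ {a} → a ≤ pred n₁ →
            (2 * pred n₁ + best a m) + best (pred n₁) m ≤ 2 * a + D) where

    -- Both bounds grow by at least one per letter, so lengthening the shorter arm absorbs
    -- `∣ x - y ∣`; then both lengths are raised to the maximum.
    opposing : ∀ {x y p q} → x ≤ n₁ → y ≤ n₁ → 1 ≤ x → 1 ≤ y →
               p ≤ best x m₁ → q ≤ dip (pred y) → ∣ x - y ∣ + (p + q) ≤ D
    opposing {suc x} {suc y} {p} {q} x≤ y≤ _ _ p≤ q≤ = begin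
      ∣ x - y ∣ + (p + q)                   ≤⟨ +-monoʳ-≤ ∣ x - y ∣ (+-mono-≤ p≤ q≤) ⟩
      ∣ x - y ∣ + (best (suc x) m₁ + dip y) ≤⟨ compare (≤-total x y) ⟩
      best n₁ m₁ + dip (pred n₁)            ≤⟨ two ⟩
      D                                     ∎
      where
      open ≤-Reasoning
      swap : ∀ a b c → a + (b + c) ≡ b + (a + c)
      swap = solve-∀
      compare : x ≤ y ⊎ y ≤ x →
                ∣ x - y ∣ + (best (suc x) m₁ + dip y) ≤ best n₁ m₁ + dip (pred n₁)
      compare (inj₁ x≤y) = begin
        ∣ x - y ∣ + (best (suc x) m₁ + dip y) ≡⟨ sym (+-assoc ∣ x - y ∣ _ _) ⟩
        ∣ x - y ∣ + best (suc x) m₁ + dip y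
          ≤⟨ +-mono-≤ (≤-trans (best-gap m₂ (s≤s x≤y)) (best-monoˡ m₂ y≤))
                      (dip-mono (pred-mono-≤ y≤)) ⟩
        best n₁ m₁ + dip (pred n₁)            ∎
      compare (inj₂ y≤x) = begin
        ∣ x - y ∣ + (best (suc x) m₁ + dip y) ≡⟨ swap ∣ x - y ∣ (best (suc x) m₁) (dip y) ⟩
        best (suc x) m₁ + (∣ x - y ∣ + dip y)
          ≡⟨ cong (λ t → best (suc x) m₁ + (t + dip y)) (∣-∣-comm x y) ⟩
        best (suc x) m₁ + (∣ y - x ∣ + dip y)
          ≤⟨ +-mono-≤ (best-monoˡ m₂ x≤)
                      (≤-trans (increasing⇒gap dip dip-increasing y≤x)
                               (dip-mono (pred-mono-≤ x≤))) ⟩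
        best n₁ m₁ + dip (pred n₁)            ∎

    parallel-≤ : ∀ {x y a b} → x ≤ n₁ → y ≤ n₁ → suc a ≤ x → suc b ≤ y → a ≤ b →
                 ∣ x - y ∣ + (∣ a - b ∣ + (best a m + best b m)) ≤ D
    -- Adding `a` to each of the two differences makes it at most `pred n₁`, by `spread`; hence the
    -- summand `2 * a`, which matches `many`.
    parallel-≤ {suc x} {suc y} {a} {b} x≤ y≤ (s≤s a≤x) (s≤s b≤y) a≤b = +-cancelˡ-≤ (2 * a) _ _ (begin
      2 * a + (∣ x - y ∣ + (∣ a - b ∣ + (best a m + best b m)))
        ≡⟨ regroup a ∣ x - y ∣ ∣ a - b ∣ (best a m) (best b m) ⟩
      ((a + ∣ x - y ∣) + (a + ∣ a - b ∣)) + best a m + best b m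
        ≤⟨ +-mono-≤ (+-monoˡ-≤ (best a m)
             (+-mono-≤ (spread a≤x (≤-trans a≤b b≤y) (pred-mono-≤ x≤) (pred-mono-≤ y≤))
                       (spread ≤-refl a≤b (≤-trans a≤b b≤N) b≤N)))
             (best-monoˡ m₁ b≤N) ⟩
      (N + N) + best a m + best N m
        ≡⟨ cong (λ t → t + best a m + best N m) (double N) ⟩
      2 * N + best a m + best N m
        ≤⟨ many (≤-trans a≤b b≤N) ⟩
      2 * a + D ∎)
      where
      open ≤-Reasoning
      N = pred n₁
      b≤N : b ≤ N
      b≤N = ≤-trans b≤y (pred-mono-≤ y≤)
      double : ∀ n → n + n ≡ 2 * n
      double = solve-∀
      regroup : ∀ a e f p q → 2 * a + (e + (f + (p + q))) ≡ ((a + e) + (a + f)) + p + q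
      regroup = solve-∀

    parallel : ∀ {x y a b} → x ≤ n₁ → y ≤ n₁ → suc a ≤ x → suc b ≤ y →
               ∣ x - y ∣ + (∣ a - b ∣ + (best a m + best b m)) ≤ D
    parallel {x} {y} {a} {b} x≤ y≤ a< b< with ≤-total a b
    ... | inj₁ a≤b = parallel-≤ x≤ y≤ a< b< a≤b
    ... | inj₂ b≤a rewrite ∣-∣-comm x y | ∣-∣-comm a b | +-comm (best a m) (best b m) =
      parallel-≤ y≤ x≤ b< a< b≤a

    stub : ∀ {x y q} → x ≤ n₁ → y ≤ n₁ → q ≤ best y m₁ → ∣ x - y ∣ + q ≤ D
    stub {x} {y} {q} x≤ y≤ q≤ with ≤-total x y
    -- Here `suc y + best y m₁` is `best (suc y) m`, so the difference is paid for by one more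
    -- vertical letter in front.
    ... | inj₁ x≤y = begin
      ∣ x - y ∣ + q     ≤⟨ +-mono-≤ ∣x-y∣≤ q≤ ⟩
      suc y + best y m₁ ≤⟨ best-monoˡ m₁ (s≤s y≤) ⟩
      best (suc n₁) m   ≤⟨ one ⟩
      D                 ∎
      where
      open ≤-Reasoning
      ∣x-y∣≤ : ∣ x - y ∣ ≤ suc y
      ∣x-y∣≤ = m≤n⇒m≤1+n (≤-trans (∣m-n∣≤m⊔n x y) (≤-reflexive (m≤n⇒m⊔n≡n x≤y)))
    ... | inj₂ y≤x = begin
      ∣ x - y ∣ + q              ≤⟨ +-monoʳ-≤ ∣ x - y ∣ q≤ ⟩
      ∣ x - y ∣ + best y m₁      ≡⟨ cong (_+ best y m₁) (∣-∣-comm x y) ⟩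
      ∣ y - x ∣ + best y m₁      ≤⟨ best-gap m₂ y≤x ⟩
      best x m₁                  ≤⟨ best-monoˡ m₂ x≤ ⟩
      best n₁ m₁                 ≤⟨ m≤m+n _ _ ⟩
      best n₁ m₁ + dip (pred n₁) ≤⟨ two ⟩
      D                          ∎
      where open ≤-Reasoning

    after-u : ∀ {x y xs ys} → x ≤ n₁ → y ≤ n₁ → total xs ≤ best x m₁ → total ys ≤ best y m₁ →
              First u 1 m₁ x xs → First u 1 m₁ y ys → ∣ x - y ∣ + dist xs ys ≤ D
    after-u x≤ y≤ _ q≤ flat _ = stub x≤ y≤ q≤
    after-u {x} {y} x≤ y≤ p≤ _ (first _ _ _ _) flat rewrite ∣-∣-comm x y = stub y≤ x≤ p≤
    after-u {x} {y} x≤ y≤ p≤ q≤ (first {c} {n′ = a} {v} c⟂r σ p (some a<x g))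
            (first {c′} {n′ = b} {w} c′⟂r σ′ q (some b<y h)) with c ≟ˡ c′
    ... | yes _ = ≤-trans
      (+-monoʳ-≤ ∣ x - y ∣ (+-monoʳ-≤ ∣ a - b ∣
        (≤-trans (dist≤total (verticals v) (verticals w))
          (+-mono-≤ (total≤best-m (climb-sum σ) p) (total≤best-m (climb-sum σ′) q)))))
      (parallel x≤ y≤ a<x b<y)
    after-u x≤ y≤ p≤ _ (first u⟂r _ _ (some a<x _)) (first {n′ = b} d⟂r down q (some b<y h)) | no _ =
      opposing x≤ y≤ (≤-trans (s≤s z≤n) a<x) (≤-trans (s≤s z≤n) b<y) p≤ (dip-bound q (h ud))
    after-u {x} {y} x≤ y≤ _ q≤ (first {n′ = a} {w = v} d⟂r down p (some a<x g))
            (first {n′ = b} {w} u⟂r _ _ (some b<y _)) | no _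
      rewrite ∣-∣-comm x y | +-comm (suc a + total (verticals v)) (suc b + total (verticals w)) =
      opposing y≤ x≤ (≤-trans (s≤s z≤n) b<y) (≤-trans (s≤s z≤n) a<x) q≤ (dip-bound p (g ud))
    after-u _ _ _ _ (first u⟂r _ _ _) (first u⟂r _ _ _) | no u≢u = contradiction refl u≢u
    after-u _ _ _ _ (first d⟂r _ _ _) (first d⟂r _ _ _) | no d≢d = contradiction refl d≢d

    dist-bound : ∀ {v w : Vec Link (suc n₁)} → Path r 0 m v → Path r 0 m w →
                 dist (verticals v) (verticals w) ≤ D
    dist-bound p q = go (firstVertical p) (firstVertical q)
                        (≤-trans (total≤best refl p) one) (≤-trans (total≤best refl q) one)
      where
      go : ∀ {xs ys} → First r 0 m (suc n₁) xs → First r 0 m (suc n₁) ys →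
           total xs ≤ D → total ys ≤ D → dist xs ys ≤ D
      go flat _ _ ys≤ = ys≤
      go (first _ _ _ _) flat xs≤ _ = xs≤
      -- From height 0 the first vertical link can only point up, so the two first links always
      -- agree.
      go (first u⟂r up p (some x≤ _)) (first u⟂r up q (some y≤ _)) _ _ =
        after-u (s≤s⁻¹ x≤) (s≤s⁻¹ y≤) (total≤best refl p) (total≤best refl q)
                (firstVertical p) (firstVertical q)

  -- Growth and convexity of the greedy weight

  count-increasing : ∀ n i → count n i < count (suc (suc n)) i
  count-increasing zero    zero    = s≤s z≤n
  count-increasing zero    (suc i) = s≤s z≤n
  count-increasing (suc n) zero    = count-increasing n m
  count-increasing (suc n) (suc i) = s≤s (count-increasing n i)

  best-suc² : ∀ n i → best (suc (suc n)) i ≡ best n i + (count (suc n) i + count (suc (suc n)) i)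
  best-suc² n i rewrite best-suc (suc n) i | best-suc n i = +-assoc (best n i) _ _

  -- Two further letters add two consecutive counts, and each count rises with two letters more, as
  -- no two consecutive greedy letters are horizontal.
  best-convex : ∀ n i → 2 + 2 * best (2 + n) i ≤ best (4 + n) i + best n i
  best-convex n i = begin
    2 + 2 * best (2 + n) i
      ≡⟨ split (best (2 + n) i) ⟩
    2 + best (2 + n) i + best (2 + n) i
      ≡⟨ cong (λ t → 2 + best (2 + n) i + t) (best-suc² n i) ⟩
    2 + best (2 + n) i + (best n i + (count (1 + n) i + count (2 + n) i))
      ≡⟨ regroup (best (2 + n) i) (best n i) (count (1 + n) i) (count (2 + n) i) ⟩
    best (2 + n) i + (suc (count (1 + n) i) + suc (count (2 + n) i)) + best n i
      ≤⟨ +-monoˡ-≤ (best n i) (+-monoʳ-≤ (best (2 + n) i)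
           (+-mono-≤ (count-increasing (1 + n) i) (count-increasing (2 + n) i))) ⟩
    best (2 + n) i + (count (3 + n) i + count (4 + n) i) + best n i
      ≡⟨ cong (_+ best n i) (sym (best-suc² (2 + n) i)) ⟩
    best (4 + n) i + best n i ∎
    where
    open ≤-Reasoning
    split : ∀ b → 2 + 2 * b ≡ 2 + b + b
    split = solve-∀
    regroup : ∀ b c e f → 2 + b + (c + (e + f)) ≡ b + (suc e + suc f) + c
    regroup = solve-∀

  -- A greedy word starts with two vertical links, so each letter beyond the first adds at least 2.
  best-steep : ∀ t n → 2 * t + best (suc n) m ≤ best (t + suc n) m
  best-steep zero    n = ≤-refl
  best-steep (suc t) n = begin
    2 * suc t + best (suc n) m                     ≡⟨ shift t (best (suc n) m) ⟩
    (2 * t + best (suc n) m) + 2                   ≤⟨ +-mono-≤ (best-steep t n) two≤count ⟩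
    best (t + suc n) m + count (suc (t + suc n)) m ≡⟨ sym (best-suc (t + suc n) m) ⟩
    best (suc t + suc n) m                         ∎
    where
    open ≤-Reasoning
    shift : ∀ t b → 2 * suc t + b ≡ (2 * t + b) + 2
    shift = solve-∀
    two≤count : 2 ≤ count (suc (t + suc n)) m
    two≤count rewrite +-suc t n = s≤s (s≤s z≤n)

  8≤best : 8 ≤ best 4 m
  8≤best = +-monoʳ-≤ 7 (positive m₂)
    where
    positive : ∀ i → 1 ≤ best 2 i
    positive zero    = s≤s z≤n
    positive (suc i) = s≤s z≤n

  -- The first letter adds only 1, but `8≤best` shows that this deficit is made up by length 4.
  best-steep₀ : ∀ {a n} → a ≤ 4 + n → 2 * (4 + n) + best a m ≤ 2 * a + best (4 + n) m
  best-steep₀ {zero} {n} _ = begin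
    2 * (4 + n) + 0     ≡⟨ expand n ⟩
    2 * n + 8           ≤⟨ +-monoʳ-≤ (2 * n) 8≤best ⟩
    2 * n + best 4 m    ≤⟨ best-steep n 3 ⟩
    best (n + 4) m      ≡⟨ cong (λ k → best k m) (+-comm n 4) ⟩
    best (4 + n) m      ∎
    where
    open ≤-Reasoning
    expand : ∀ n → 2 * (4 + n) + 0 ≡ 2 * n + 8
    expand = solve-∀
  best-steep₀ {suc a} {n} a≤ = begin
    2 * (4 + n) + best (suc a) m             ≡⟨ cong (λ k → 2 * k + best (suc a) m) (sym N≡) ⟩
    2 * (t + suc a) + best (suc a) m         ≡⟨ expand t a (best (suc a) m) ⟩
    2 * suc a + (2 * t + best (suc a) m)     ≤⟨ +-monoʳ-≤ (2 * suc a) (best-steep t a) ⟩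
    2 * suc a + best (t + suc a) m           ≡⟨ cong (λ k → 2 * suc a + best k m) N≡ ⟩
    2 * suc a + best (4 + n) m               ∎
    where
    open ≤-Reasoning
    t = 4 + n ∸ suc a
    N≡ : t + suc a ≡ 4 + n
    N≡ = m∸n+n≡m a≤
    expand : ∀ t a b → 2 * (t + suc a) + b ≡ 2 * suc a + (2 * t + b)
    expand = solve-∀

  module Long (n : ℕ) where

    D : ℕ
    D = best (5 + n) m₁ + dip (4 + n)

    one : best (6 + n) m ≤ D
    one = begin
      6 + n + best (5 + n) m₁            ≡⟨ swap n (best (5 + n) m₁) ⟩
      best (5 + n) m₁ + (4 + n + 2)      ≤⟨ +-monoʳ-≤ (best (5 + n) m₁)
                                              (+-monoʳ-≤ (4 + n) (s≤s (s≤s z≤n))) ⟩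
      best (5 + n) m₁ + (4 + n + best (2 + n) m) ∎
      where
      open ≤-Reasoning
      swap : ∀ n b → 6 + n + b ≡ b + (4 + n + 2)
      swap = solve-∀

    -- Unfolding the outer terms of `best-convex` gives exactly `2 + D`.
    twice : 2 * best (4 + n) m ≤ D
    twice = +-cancelˡ-≤ 2 _ _ (begin
      2 + 2 * best (4 + n) m              ≤⟨ best-convex (2 + n) m ⟩
      best (6 + n) m + best (2 + n) m     ≡⟨ swap n (best (5 + n) m₁) (best (2 + n) m) ⟩
      2 + D                               ∎)
      where
      open ≤-Reasoning
      swap : ∀ n b c → 6 + n + b + c ≡ 2 + (b + (4 + n + c))
      swap = solve-∀

    many : ∀ {a} → a ≤ 4 + n → (2 * (4 + n) + best a m) + best (4 + n) m ≤ 2 * a + D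
    many {a} a≤ = begin
      (2 * (4 + n) + best a m) + best (4 + n) m ≤⟨ +-monoˡ-≤ (best (4 + n) m) (best-steep₀ a≤) ⟩
      2 * a + best (4 + n) m + best (4 + n) m   ≡⟨ fold a (best (4 + n) m) ⟩
      2 * a + 2 * best (4 + n) m                ≤⟨ +-monoʳ-≤ (2 * a) twice ⟩
      2 * a + D                                 ∎
      where
      open ≤-Reasoning
      fold : ∀ a b → 2 * a + b + b ≡ 2 * a + 2 * b
      fold = solve-∀

    open Bound {5 + n} {D} one ≤-refl many public using (dist-bound)

  -- Short arms by finite checks

  short-two : ∀ {n₁} → n₁ < 5 → best n₁ m₁ + dip (pred n₁) ≤ best (suc n₁) m
  short-two {n₁} n₁<5 = ≤-trans (≤-reflexive (+-comm (best n₁ m₁) _))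
                                (+-monoˡ-≤ (best n₁ m₁) (dip≤ n₁<5))
    where
    dip≤ : ∀ {n₁} → n₁ < 5 → dip (pred n₁) ≤ suc n₁
    -- The check stops where the formula changes: at `n₁ = 5` the value `dip 4` is 7 and exceeds 6.
    dip≤ = from-yes (allUpTo? (λ n₁ → dip (pred n₁) ≤? suc n₁) 5)

short-many : ∀ m₂ {n₁} → n₁ < 5 → ∀ {a} → a < suc (pred n₁) →
             let open Greedy (2 + m₂) ; m = 2 + m₂ in
             (2 * pred n₁ + best a m) + best (pred n₁) m ≤ 2 * a + best (suc n₁) m
short-many = λ where
    0                         → from-yes (search 0)
    1                         → from-yes (search 1)
    2                         → from-yes (search 2)
    -- From width 5 on, words of length at most 5 never reach a forced horizontal letter, so the
    -- check computes with a symbolic width.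
    (suc (suc (suc m₅)))      → from-yes (search (3 + m₅))
  where
  search : ∀ m₂ → let open Greedy (2 + m₂) ; m = 2 + m₂ in
           Dec (∀ {n₁} → n₁ < 5 → ∀ {a} → a < suc (pred n₁) →
                (2 * pred n₁ + best a m) + best (pred n₁) m ≤ 2 * a + best (suc n₁) m)
  search m₂ = allUpTo? (λ n₁ → allUpTo? (λ a → _ ≤? _) (suc (pred n₁))) 5

-- Distances between the special positions

verticals-H : ∀ m n → verticals (H-word m n) ≡ []
verticals-H m zero    = refl
verticals-H m (suc n) = verticals-H m n

module SpecialPositions (m₂ : ℕ) where

  open Tunnel m₂
  open Greedy m

  mutual

    total-ups : ∀ n i →
      total (verticals (prefix n (toList (replicate i u ++⁺ (r ∷ (replicate m d ++ r ∷ []))))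
                                 (block m))) ≡ best n i
    total-ups zero    _       = refl
    total-ups (suc n) zero    = total-downs n m
    total-ups (suc n) (suc i) = cong (λ t → suc n + t) (total-ups n i)

    total-downs : ∀ n i →
      total (verticals (prefix n (replicate i d ++ r ∷ []) (block m))) ≡ best n i
    total-downs zero    _       = refl
    total-downs (suc n) zero    = total-L n
    total-downs (suc n) (suc i) = cong (λ t → suc n + t) (total-downs n i)

    total-L : ∀ n → total (verticals (L-word m n)) ≡ best n m
    total-L zero    = refl
    total-L (suc n) = cong (λ t → suc n + t) (total-ups n m₁)

  δ-L-H : ∀ n → δ (L m n) (H m n) ≡ best n m
  δ-L-H n = begin
    dist (verticals (L-word m n)) (verticals (H-word m n)) ≡⟨ cong (dist (verticals (L-word m n))) (verticals-H m n) ⟩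
    dist (verticals (L-word m n)) []                       ≡⟨ dist-sym (verticals (L-word m n)) [] ⟩
    total (verticals (L-word m n))                         ≡⟨ total-L n ⟩
    best n m                                               ∎
    where open ≡-Reasoning

  -- The first links cancel. The second vertical links, where both exist, are `u` and `d`, so all
  -- later weights count in full.
  δ-L-L⁺ : ∀ n (1≤m : 1 ≤ m) →
           δ (L m (suc n)) (L⁺ m (suc n) 1≤m) ≡ best n m₁ + dip (pred n)
  δ-L-L⁺ 0 _ = refl
  δ-L-L⁺ 1 _ = refl
  δ-L-L⁺ 2 _ = cong (λ t → 2 + t + 1) (total-ups 1 m₂)
  δ-L-L⁺ (suc (suc (suc n))) _ rewrite ∣n-n∣≡0 n =
    cong₂ (λ p q → (3 + n + p) + (2 + n + q)) (total-ups (2 + n) m₂) (total-L n)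

  best+z : ∀ n → best n m + z m n ≡ s n
  best+z n = trans (cong (λ t → best n m + t) (sym (rest≡z n))) (best+rest n m)

  best₁+z : ∀ n → best n m₁ + z m (suc n) ≡ s n
  best₁+z n = trans (cong (λ t → best n m₁ + t) (sym (rest≡z (suc n)))) (best+rest n m₁)

  m+k∸3≤m : ∀ k → k ≤ 3 → m + k ∸ 3 ≤ m
  m+k∸3≤m k k≤3 = ≤-trans (∸-monoʳ-≤ (m + k) k≤3) (≤-reflexive (m+n∸n≡m m k))

  -- Prefixing `m` vertical letters to a greedy word with empty budget keeps its horizontal weight
  -- (`rest-shift`), which explains the index of `z`. For the two smallest lengths there is no
  -- horizontal weight.
  dip+z : ∀ n → dip (pred n) + z m (m + suc n ∸ 3) ≡ s (pred n)
  dip+z 0 = trans (sym (rest≡z (m + 1 ∸ 3))) (rest-short (m+k∸3≤m 1 (s≤s z≤n)))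
  dip+z 1 = trans (sym (rest≡z (m + 2 ∸ 3))) (rest-short (m+k∸3≤m 2 (s≤s (s≤s z≤n))))
  dip+z (suc (suc n)) = begin
    suc n + best n 0 + z m (m + (3 + n) ∸ 3)
      ≡⟨ cong (λ k → suc n + best n 0 + z m k) (+-∸-assoc m {3 + n} {3} (s≤s (s≤s (s≤s z≤n)))) ⟩
    suc n + best n 0 + z m (m + n)
      ≡⟨ cong (λ t → suc n + best n 0 + t) (trans (sym (rest≡z (m + n))) (rest-shift m n)) ⟩
    suc n + best n 0 + rest n 0
      ≡⟨ +-assoc (suc n) (best n 0) (rest n 0) ⟩
    suc n + (best n 0 + rest n 0)
      ≡⟨ cong (λ t → suc n + t) (best+rest n 0) ⟩
    suc n + s n
      ≡⟨ sym (s-suc n) ⟩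
    s (suc n) ∎
    where open ≡-Reasoning

-- Integer formulas and the diameter

+≡⇒≡- : ∀ a b {c} → a + b ≡ c → + a ≡ + c - + b
+≡⇒≡- a b refl = sym (begin
  + (a + b) - + b  ≡⟨ ℤ.m-n≡m⊖n (a + b) b ⟩
  (a + b) ⊖ b      ≡⟨ ℤ.⊖-≥ (m≤n+m b a) ⟩
  + (a + b ∸ b)    ≡⟨ cong +_ (m+n∸n≡m a b) ⟩
  + a              ∎)
  where open ≡-Reasoning

theorem1p7 : ∀ (m n : ℕ) (2≤m : 2 ≤ m) → 1 ≤ n →
    ∃[ dH ] ∃[ d⁺ ]
    ( G.IsDistance m n (L m n) (H m n) dH
    × G.IsDistance m n (L m n) (L⁺ m n (<⇒≤ 2≤m)) d⁺
    × (n < 6 → G.IsDiameter m n dH)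
    × (6 ≤ n → G.IsDiameter m n d⁺)
    × + dH ≡ + s n - + z m n
    × + d⁺ ≡ (+ s (n ∸ 1) - + z m n) +ℤ (+ s (n ∸ 2) - + z m (m + n ∸ 3)) )
theorem1p7 (suc (suc m₂)) (suc n) 2≤m@(s≤s (s≤s _)) _ =
  dH , d⁺ , L-H , L-L⁺ , short , long , +≡⇒≡- dH (z m (suc n)) (best+z (suc n)) ,
  cong₂ _+ℤ_ (+≡⇒≡- (best n m₁) (z m (suc n)) (best₁+z n))
             (+≡⇒≡- (dip (pred n)) (z m (m + suc n ∸ 3)) (dip+z n))
  where
  open Tunnel m₂
  open Greedy m
  open SpecialPositions m₂
  dH = best (suc n) m
  d⁺ = best n m₁ + dip (pred n)
  L-H : G.IsDistance m (suc n) (L m (suc n)) (H m (suc n)) dH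
  L-H = subst (G.IsDistance m (suc n) _ _) (δ-L-H (suc n)) (δ-isDistance _ _)
  L-L⁺ : G.IsDistance m (suc n) (L m (suc n)) (L⁺ m (suc n) (<⇒≤ 2≤m)) d⁺
  L-L⁺ = subst (G.IsDistance m (suc n) _ _) (δ-L-L⁺ n (<⇒≤ 2≤m)) (δ-isDistance _ _)
  short : suc n < 6 → G.IsDiameter m (suc n) dH
  short (s≤s n<5) =
    (λ p q → δ p q , δ-isDistance p q ,
      Bound.dist-bound ≤-refl (short-two n<5) (λ a≤ → short-many m₂ n<5 (s≤s a≤)) (path p) (path q)) ,
    (_ , _ , L-H)
  long : 6 ≤ suc n → G.IsDiameter m (suc n) d⁺
  -- The match writes the length as `6 + k`, where `d⁺` is the `D` of `Long` by computation.
  long (s≤s (s≤s (s≤s (s≤s (s≤s (s≤s (z≤n {k}))))))) =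
    (λ p q → δ p q , δ-isDistance p q , Long.dist-bound k (path p) (path q)) ,
    (_ , _ , L-L⁺)
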